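{- Let $k$ be an integer. There are infinitely many integers in $C_k$ with exactly two prime factors if and only if $k>0$ and $k$ is prime. Moreover: (1) for any integer $k$, there are only finitely many elements of $C_k$ of the form $pq$ with $p\neq q$ primes both coprime to $k$; (2) if $k<0$, or if $k>0$ and $k$ is not prime, then there are only finitely many elements of $C_k$ with exactly two prime factors at least one of which divides $k$.
   Context: For an integer $k$, $C_k$ denotes the set of integers $n>\max(k,0)$ such that $a^{n-k+1}\equiv a \pmod{n}$ for all integers $a$. -}

module Defs where

open import Data.Nat as ℕ using (ℕ)
open import Data.Integer as ℤ using (ℤ; +_; ∣_∣)
open import Data.Integer.Divisibility as ℤD using ()
open import Data.Integer.Coprimality as ℤC using ()
open import Data.Nat.Primality using (Prime)
open import Data.Product using (Σ; ∃; ∃-syntax; _×_)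
open import Data.Sum using (_⊎_)
open import Relation.Binary.PropositionalEquality using (_≡_)
open import Relation.Nullary using (¬_)

-- n ∈ C_k :  n > max(k,0)  and  a^(n-k+1) ≡ a (mod n) for all integers a.
-- Since n > k, the exponent n - k + 1 is a positive integer; we take its
-- absolute value as a natural number exponent.
InC : ℤ → ℕ → Set
InC k n =
  (k ℤ.< + n) × (0 ℕ.< n) ×
  ((a : ℤ) → (+ n) ℤD.∣ ((a ℤ.^ ∣ ((+ n) ℤ.- k) ℤ.+ (+ 1) ∣) ℤ.- a))

TwoPrimeFactors : ℕ → Set
TwoPrimeFactors n = ∃[ p ] ∃[ q ] (Prime p × Prime q × n ≡ p ℕ.* q)

Infinite : (ℕ → Set) → Set
Infinite P = (N : ℕ) → ∃[ n ] (N ℕ.< n × P n)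

Finite : (ℕ → Set) → Set
Finite P = ∃[ N ] ((n : ℕ) → P n → n ℕ.≤ N)

IsPrimeℤ : ℤ → Set
IsPrimeℤ k = (ℤ.+ 0 ℤ.< k) × Prime ∣ k ∣

DistinctPrimesCoprimeTo : ℤ → ℕ → Set
DistinctPrimesCoprimeTo k n =
  ∃[ p ] ∃[ q ] (Prime p × Prime q × ¬ (p ≡ q) × n ≡ p ℕ.* q ×
                 ℤC.Coprime (+ p) k × ℤC.Coprime (+ q) k)

TwoPrimesOneDividing : ℤ → ℕ → Set
TwoPrimesOneDividing k n =
  ∃[ p ] ∃[ q ] (Prime p × Prime q × n ≡ p ℕ.* q ×
                 ((+ p) ℤD.∣ k ⊎ (+ q) ℤD.∣ k))

{-# OPTIONS --safe #-}

-- If p ≠ q and p q lies in C_k, then p - 1 divides q - k and q - 1 divides p - k (Korselt's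
-- criterion), and when neither prime equals k this bounds both of them in terms of |k|.  A square
-- never lies in C_k, and a prime equal to k requires k to be a positive prime.  Conversely, for k
-- prime, k q lies in C_k for every prime q > k with q ≡ 1 modulo k - 1.  Such primes are found among
-- the divisors of the value of a cyclotomic polynomial, built by successive exact division of values
-- x ^ e - 1 at a multiple x of the primes involved.

module Submission where

open import Defs
open import Data.Empty using (⊥; ⊥-elim)
open import Data.Integer as ℤ using (ℤ; +_; -[1+_]; _<_; _≤_; +<+; ∣_∣; _+_; _*_; _-_; -_; _^_)
open import Data.Integer.DivMod using (_%ℕ_; _/ℕ_; a≡a%ℕn+[a/ℕn]*n)
open import Data.Integer.Divisibility.Signed
  using (_∣_; _∣?_; divides; ∣ᵤ⇒∣; ∣⇒∣ᵤ; *-cancelʳ-∣; ∣-refl; ∣-trans; ∣m∣n⇒∣m+n; ∣m∣n⇒∣m-n; ∣m⇒∣-m; ∣m⇒∣m*n; ∣n⇒∣m*n)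
open import Data.Integer.Properties as ℤP using (_<?_; pos-+; pos-*; abs-*; ^-*-assoc; ^-zeroˡ; ^-distribˡ-+-*)
open import Data.Integer.Tactic.RingSolver using (solve-∀)
open import Data.List using ([]; _∷_)
open import Data.List.Relation.Unary.All using ([]; _∷_)
open import Data.Nat.ListAction using (product)
open import Data.Nat as ℕ using (ℕ; zero; suc; s≤s; NonZero; _!; _∸_)
open import Data.Nat.Combinatorics using (_C_; nC1≡n; nCn≡1; nCk+nC[k+1]≡[n+1]C[k+1])
open import Data.Nat.Coprimality as ℕC using (Coprime; coprime-Bézout; coprime-divisor; prime⇒coprime)
open import Data.Nat.Divisibility as ℕD using ()
open import Data.Nat.DivMod as ℕDM using ()
open import Data.Nat.GCD using (module Bézout; gcd; gcd-GCD; gcd[m,n]∣m; gcd[m,n]∣n)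
open import Data.Nat.Primality
open import Data.Nat.Primality.Factorisation using (factorise)
open import Data.Nat.Properties as ℕP using ()
open import Data.Nat.Tactic.RingSolver as ℕR using ()
open import Data.Product using (∃-syntax; _×_; _,_; proj₁; proj₂)
open import Data.Sum using (_⊎_; inj₁; inj₂; [_,_]′)
open import Function using (_∘_)
open import Function.Bundles using (_⇔_; mk⇔)
open import Relation.Binary.PropositionalEquality
open import Relation.Binary.Definitions using (tri<; tri≈; tri>)
open import Relation.Nullary using (¬_; Dec; yes; no; contradiction)
open import Relation.Nullary.Decidable using (_×-dec_)

private
  variable
    a b c d : ℤ
    m n : ℕ

-- Congruences

infix 4 _≈_[_]

record _≈_[_] (a b : ℤ) (n : ℕ) : Set where
  constructor cong-mod
  field difference : + n ∣ a - b

open _≈_[_]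

≈-refl : a ≈ a [ n ]
≈-refl {a} = cong-mod (divides (+ 0) (ℤP.+-inverseʳ a))

≈-reflexive : a ≡ b → a ≈ b [ n ]
≈-reflexive refl = ≈-refl

≈-sym : a ≈ b [ n ] → b ≈ a [ n ]
≈-sym {a} {b} (cong-mod d) = cong-mod (subst (_ ∣_) (eq a b) (∣m⇒∣-m d))
  where
  eq : ∀ a b → - (a - b) ≡ b - a
  eq = solve-∀

≈-trans : a ≈ b [ n ] → b ≈ c [ n ] → a ≈ c [ n ]
≈-trans {a} {b} {_} {c} (cong-mod d) (cong-mod e) = cong-mod (subst (_ ∣_) (eq a b c) (∣m∣n⇒∣m+n d e))
  where
  eq : ∀ a b c → a - b + (b - c) ≡ a - c
  eq = solve-∀

+-cong-≈ : a ≈ b [ n ] → c ≈ d [ n ] → a + c ≈ b + d [ n ]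
+-cong-≈ {a} {b} {_} {c} {d} (cong-mod e) (cong-mod f) = cong-mod (subst (_ ∣_) (eq a b c d) (∣m∣n⇒∣m+n e f))
  where
  eq : ∀ a b c d → a - b + (c - d) ≡ a + c - (b + d)
  eq = solve-∀

-cong-≈ : a ≈ b [ n ] → c ≈ d [ n ] → a - c ≈ b - d [ n ]
-cong-≈ {a} {b} {_} {c} {d} (cong-mod e) (cong-mod f) = cong-mod (subst (_ ∣_) (eq a b c d) (∣m∣n⇒∣m-n e f))
  where
  eq : ∀ a b c d → a - b - (c - d) ≡ a - c - (b - d)
  eq = solve-∀

*-cong-≈ : a ≈ b [ n ] → c ≈ d [ n ] → a * c ≈ b * d [ n ]
*-cong-≈ {a} {b} {_} {c} {d} (cong-mod e) (cong-mod f) =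
  cong-mod (subst (_ ∣_) (eq a b c d) (∣m∣n⇒∣m+n (∣m⇒∣m*n c e) (∣n⇒∣m*n b f)))
  where
  eq : ∀ a b c d → (a - b) * c + b * (c - d) ≡ a * c - b * d
  eq = solve-∀

^-cong-≈ : a ≈ b [ n ] → ∀ e → a ^ e ≈ b ^ e [ n ]
^-cong-≈ a≈b zero    = ≈-refl
^-cong-≈ a≈b (suc e) = *-cong-≈ a≈b (^-cong-≈ a≈b e)

∣⇒≈0 : + n ∣ a → a ≈ + 0 [ n ]
∣⇒≈0 {_} {a} n∣a = cong-mod (subst (_ ∣_) (sym (ℤP.+-identityʳ a)) n∣a)

≈0⇒∣ : a ≈ + 0 [ n ] → + n ∣ a
≈0⇒∣ {a} (cong-mod n∣a) = subst (_ ∣_) (ℤP.+-identityʳ a) n∣a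

≈1-^ : a ≈ + 1 [ n ] → ∀ e → a ^ e ≈ + 1 [ n ]
≈1-^ a≈1 e = ≈-trans (^-cong-≈ a≈1 e) (≈-reflexive (^-zeroˡ e))

≈1-^* : ∀ e f → a ^ e ≈ + 1 [ n ] → a ^ (e ℕ.* f) ≈ + 1 [ n ]
≈1-^* {a} e f h = ≈-trans (≈-reflexive (sym (^-*-assoc a e f))) (≈1-^ h f)

euclid : ∀ {p} → Prime p → ∀ a b → + p ∣ a * b → (+ p ∣ a) ⊎ (+ p ∣ b)
euclid pp a b p∣ab =
  [ inj₁ ∘ ∣ᵤ⇒∣ , inj₂ ∘ ∣ᵤ⇒∣ ]′ (euclidsLemma ∣ a ∣ ∣ b ∣ pp (subst (_ ℕD.∣_) (abs-* a b) (∣⇒∣ᵤ p∣ab)))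

*-cancelˡ-≈ : ∀ {p} → Prime p → ∀ a {b c} → ¬ + p ∣ a → a * b ≈ a * c [ p ] → b ≈ c [ p ]
*-cancelˡ-≈ pp a {b} {c} p∤a (cong-mod d) with euclid pp a (b - c) (subst (_ ∣_) (eq a b c) d)
  where
  eq : ∀ a b c → a * b - a * c ≡ a * (b - c)
  eq = solve-∀
... | inj₁ p∣a = contradiction p∣a p∤a
... | inj₂ h   = cong-mod h

prime∤1 : ∀ {p} → Prime p → ¬ + p ∣ + 1
prime∤1 pp h with ℕD.∣1⇒≡1 (∣⇒∣ᵤ h)
... | refl = ¬prime[1] pp

-- Fermat's little theorem

-- The absorption identity, by induction from Pascal's rule; it exposes the factor `p` in the inner
-- binomial coefficients of row `p`.
[k+1]*[n+1]C[k+1] : ∀ n k → suc k ℕ.* (suc n C suc k) ≡ suc n ℕ.* (n C k)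
[k+1]*[n+1]C[k+1] zero    zero    = refl
[k+1]*[n+1]C[k+1] zero    (suc k) = ℕP.*-zeroʳ (suc (suc k))
[k+1]*[n+1]C[k+1] (suc n) zero    =
  trans (ℕP.*-identityˡ _) (trans (nC1≡n (suc (suc n))) (sym (ℕP.*-identityʳ (suc (suc n)))))
[k+1]*[n+1]C[k+1] (suc n) (suc k) = begin
  suc (suc k) ℕ.* (suc (suc n) C suc (suc k))
    ≡⟨ cong (suc (suc k) ℕ.*_) (nCk+nC[k+1]≡[n+1]C[k+1] (suc n) (suc k)) ⟨
  suc (suc k) ℕ.* (u ℕ.+ v)
    ≡⟨ eq₁ k u v ⟩
  u ℕ.+ (suc k ℕ.* u ℕ.+ suc (suc k) ℕ.* v)
    ≡⟨ cong (u ℕ.+_) (cong₂ ℕ._+_ ([k+1]*[n+1]C[k+1] n k) ([k+1]*[n+1]C[k+1] n (suc k))) ⟩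
  u ℕ.+ (suc n ℕ.* (n C k) ℕ.+ suc n ℕ.* (n C suc k))
    ≡⟨ cong (u ℕ.+_) (sym (ℕP.*-distribˡ-+ (suc n) (n C k) (n C suc k))) ⟩
  u ℕ.+ suc n ℕ.* (n C k ℕ.+ n C suc k)
    ≡⟨ cong (λ t → u ℕ.+ suc n ℕ.* t) (nCk+nC[k+1]≡[n+1]C[k+1] n k) ⟩
  suc (suc n) ℕ.* u ∎
  where
  open ≡-Reasoning
  u = suc n C suc k
  v = suc n C suc (suc k)
  eq₁ : ∀ k u v → suc (suc k) ℕ.* (u ℕ.+ v) ≡ u ℕ.+ (suc k ℕ.* u ℕ.+ suc (suc k) ℕ.* v)
  eq₁ = ℕR.solve-∀

prime∣pCk : ∀ {p} → Prime p → ∀ {k} → suc k ℕ.< p → p ℕD.∣ p C suc k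
prime∣pCk {suc p} pp {k} k<p
  with euclidsLemma (suc k) _ pp (ℕD.divides (p C k) (trans ([k+1]*[n+1]C[k+1] p k) (ℕP.*-comm (suc p) (p C k))))
... | inj₁ p∣k = contradiction (ℕD.∣⇒≤ p∣k) (ℕP.<⇒≱ k<p)
... | inj₂ h   = h

-- The binomial expansion of `(1 + a) ^ n` cut off after `N` terms, so that the inner terms can be
-- discarded one by one modulo a prime.
partialBinomial : ℤ → ℕ → ℕ → ℤ
partialBinomial a n zero    = + 0
partialBinomial a n (suc N) = partialBinomial a n N + + (n C N) * a ^ N

-- Pascal's rule merges neighbouring terms into row `n + 1`; the cut-off leaves the last shifted
-- term unmatched.
partialBinomial-suc : ∀ a n N →
  (+ 1 + a) * partialBinomial a n (suc N) ≡ partialBinomial a (suc n) (suc N) + + (n C N) * a ^ suc N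
partialBinomial-suc a n zero    = eq a
  where
  eq : ∀ a → (+ 1 + a) * (+ 0 + + 1 * + 1) ≡ + 0 + + 1 * + 1 + + 1 * (a * + 1)
  eq = solve-∀
partialBinomial-suc a n (suc N) = begin
  (+ 1 + a) * (partialBinomial a n (suc N) + v * (a * x))
    ≡⟨ eq₁ a (partialBinomial a n (suc N)) v x ⟩
  (+ 1 + a) * partialBinomial a n (suc N) + (v * (a * x) + v * (a * (a * x)))
    ≡⟨ cong (_+ (v * (a * x) + v * (a * (a * x)))) (partialBinomial-suc a n N) ⟩
  partialBinomial a (suc n) (suc N) + u * (a * x) + (v * (a * x) + v * (a * (a * x)))
    ≡⟨ eq₂ (partialBinomial a (suc n) (suc N)) u v (a * x) a ⟩
  partialBinomial a (suc n) (suc N) + (u + v) * (a * x) + v * (a * (a * x))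
    ≡⟨ cong (λ t → partialBinomial a (suc n) (suc N) + t * (a * x) + v * (a * (a * x)))
         (trans (sym (pos-+ (n C N) (n C suc N))) (cong +_ (nCk+nC[k+1]≡[n+1]C[k+1] n N))) ⟩
  partialBinomial a (suc n) (suc N) + + (suc n C suc N) * (a * x) + v * (a * (a * x)) ∎
  where
  open ≡-Reasoning
  u = + (n C N)
  v = + (n C suc N)
  x = a ^ N
  eq₁ : ∀ a t v x → (+ 1 + a) * (t + v * (a * x)) ≡ (+ 1 + a) * t + (v * (a * x) + v * (a * (a * x)))
  eq₁ = solve-∀
  eq₂ : ∀ t u v y a → t + u * y + (v * y + v * (a * y)) ≡ t + (u + v) * y + v * (a * y)
  eq₂ = solve-∀

[1+a]^n : ∀ a n → (+ 1 + a) ^ n ≡ partialBinomial a n (suc n)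
[1+a]^n a zero    = refl
[1+a]^n a (suc n) = begin
  (+ 1 + a) * (+ 1 + a) ^ n                          ≡⟨ cong ((+ 1 + a) *_) ([1+a]^n a n) ⟩
  (+ 1 + a) * partialBinomial a n (suc n)            ≡⟨ partialBinomial-suc a n n ⟩
  partialBinomial a (suc n) (suc n) + + (n C n) * a ^ suc n
    ≡⟨ cong (λ t → partialBinomial a (suc n) (suc n) + + t * a ^ suc n) (trans (nCn≡1 n) (sym (nCn≡1 (suc n)))) ⟩
  partialBinomial a (suc n) (suc (suc n)) ∎
  where open ≡-Reasoning

partialBinomial≈1 : ∀ {p} → Prime p → ∀ a N → N ℕ.< p → partialBinomial a p (suc N) ≈ + 1 [ p ]
partialBinomial≈1 pp a zero    N<p = ≈-refl
partialBinomial≈1 {p} pp a (suc N) N<p =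
  +-cong-≈ (partialBinomial≈1 pp a N (ℕP.<-trans (ℕP.n<1+n N) N<p))
           (∣⇒≈0 (∣m⇒∣m*n {m = + (p C suc N)} (a ^ suc N) (∣ᵤ⇒∣ (prime∣pCk pp N<p))))

frobenius : ∀ {p} → Prime p → ∀ a → (+ 1 + a) ^ p ≈ + 1 + a ^ p [ p ]
frobenius {zero}  pp a = contradiction pp ¬prime[0]
frobenius {suc p} pp a = ≈-trans (≈-reflexive ([1+a]^n a (suc p)))
  (+-cong-≈ (partialBinomial≈1 pp a p (ℕP.n<1+n p))
     (≈-reflexive (trans (cong (λ t → + t * a ^ suc p) (nCn≡1 (suc p))) (ℤP.*-identityˡ (a ^ suc p)))))

fermat-ℕ : ∀ {p} → Prime p → ∀ x → (+ x) ^ p ≈ + x [ p ]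
fermat-ℕ {zero}  pp x       = contradiction pp ¬prime[0]
fermat-ℕ {suc p} pp zero    = ≈-refl
fermat-ℕ {suc p} pp (suc x) = ≈-trans (frobenius pp (+ x)) (+-cong-≈ (≈-refl {+ 1}) (fermat-ℕ pp x))

≈-%ℕ : ∀ a n .{{_ : NonZero n}} → a ≈ + (a %ℕ n) [ n ]
≈-%ℕ a n = cong-mod (divides (a /ℕ n) (trans (cong (_- + (a %ℕ n)) (a≡a%ℕn+[a/ℕn]*n a n)) (eq (+ (a %ℕ n)) _)))
  where
  eq : ∀ r s → r + s - r ≡ s
  eq = solve-∀

fermat : ∀ {p} → Prime p → ∀ a → a ^ p ≈ a [ p ]
fermat {p} pp a = ≈-trans (^-cong-≈ a≈r p) (≈-trans (fermat-ℕ pp (a %ℕ p)) (≈-sym a≈r))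
  where
  instance _ = prime⇒nonZero pp
  a≈r = ≈-%ℕ a p

fermat′ : ∀ {p} → Prime p → ∀ a → ¬ + p ∣ a → a ^ (p ∸ 1) ≈ + 1 [ p ]
fermat′ {zero}  pp a p∤a = contradiction pp ¬prime[0]
fermat′ {suc p} pp a p∤a = *-cancelˡ-≈ pp a p∤a (≈-trans (fermat pp a) (≈-reflexive (sym (ℤP.*-identityʳ a))))
-- Finite differences

Δ : ℕ → (ℕ → ℤ) → ℕ → ℤ
Δ zero    f x = f x
Δ (suc n) f x = Δ n f (suc x) - Δ n f x

-- The Leibniz rule for a product with the identity function; it raises the degree by one in
-- `Δ-x^n`.
Δ-x*f : ∀ n f x → Δ (suc n) (λ y → + y * f y) x ≡ + x * Δ (suc n) f x + + suc n * Δ n f (suc x)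
Δ-x*f zero f x = eq (+ x) (f x) (f (suc x))
  where
  eq : ∀ x u v → (+ 1 + x) * v - x * u ≡ x * (v - u) + + 1 * v
  eq = solve-∀
Δ-x*f (suc n) f x = trans (cong₂ _-_ (Δ-x*f n f (suc x)) (Δ-x*f n f x))
  (eq (+ x) (+ suc n) (Δ n f x) (Δ n f (suc x)) (Δ n f (suc (suc x))))
  where
  eq : ∀ x n u v w → (+ 1 + x) * (w - v) + n * w - (x * (v - u) + n * v)
                     ≡ x * (w - v - (v - u)) + (+ 1 + n) * (w - v)
  eq = solve-∀

Δ-x^n : ∀ n x → Δ n (λ y → (+ y) ^ n) x ≡ + (n !)
Δ-x^n zero    x = refl
Δ-x^n (suc n) x = begin
  Δ (suc n) (λ y → + y * (+ y) ^ n) x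
    ≡⟨ Δ-x*f n (λ y → (+ y) ^ n) x ⟩
  + x * (Δ n (λ y → (+ y) ^ n) (suc x) - Δ n (λ y → (+ y) ^ n) x) + + suc n * Δ n (λ y → (+ y) ^ n) (suc x)
    ≡⟨ cong₂ (λ u v → + x * (u - v) + + suc n * u) (Δ-x^n n (suc x)) (Δ-x^n n x) ⟩
  + x * (+ (n !) - + (n !)) + + suc n * + (n !)
    ≡⟨ eq (+ x) (+ (n !)) (+ suc n) ⟩
  + suc n * + (n !)
    ≡⟨ pos-* (suc n) (n !) ⟨
  + (suc n !) ∎
  where
  open ≡-Reasoning
  eq : ∀ x u k → x * (u - u) + k * u ≡ k * u
  eq = solve-∀

-- A difference sees only a finite window. Constancy is asked for there alone, because the powers of
-- `x` are known to be 1 only for `x` from 1 to `p - 1`.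
Δ-const : ∀ n f x {c} → (∀ y → x ℕ.≤ y → y ℕ.≤ x ℕ.+ suc n → f y ≈ c [ m ]) → Δ (suc n) f x ≈ + 0 [ m ]
Δ-const zero f x {c} h = ≈-trans
  (-cong-≈ (h (suc x) (ℕP.n≤1+n x) (ℕP.≤-reflexive (sym (ℕP.+-comm x 1)))) (h x ℕP.≤-refl (ℕP.m≤m+n x 1)))
  (≈-reflexive (ℤP.+-inverseʳ c))
Δ-const (suc n) f x h = -cong-≈
  (Δ-const n f (suc x) λ y l u → h y (ℕP.≤-trans (ℕP.n≤1+n x) l) (subst (y ℕ.≤_) (sym (ℕP.+-suc x (suc n))) u))
  (Δ-const n f x λ y l u → h y l (ℕP.≤-trans u (ℕP.+-monoʳ-≤ x (ℕP.n≤1+n (suc n)))))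

prime∣n!⇒≤ : ∀ {p} → Prime p → ∀ n → p ℕD.∣ n ! → p ℕ.≤ n
prime∣n!⇒≤ pp zero h with ℕD.∣1⇒≡1 h
... | refl = contradiction pp ¬prime[1]
prime∣n!⇒≤ pp (suc n) h with euclidsLemma (suc n) (n !) pp h
... | inj₁ h₁ = ℕD.∣⇒≤ h₁
... | inj₂ h₂ = ℕP.m≤n⇒m≤1+n (prime∣n!⇒≤ pp n h₂)

-- Korselt's criterion: an exponent r with 0 < r < p - 1 fails because the r-th difference
-- of x^r is r!, which is prime to p, whereas the r-th difference of a constant vanishes.

x^r≈1⇒p≤1+r : ∀ {p} → Prime p → ∀ r → (∀ x → 1 ℕ.≤ x → x ℕ.< p → (+ x) ^ suc r ≈ + 1 [ p ]) → p ℕ.≤ suc (suc r)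
x^r≈1⇒p≤1+r {p} pp r h = ℕP.≮⇒≥ λ r<p →
  contradiction (prime∣n!⇒≤ pp (suc r) (∣⇒∣ᵤ (≈0⇒∣ (r!≈0 r<p)))) (ℕP.<⇒≱ (ℕP.<-trans (ℕP.n<1+n (suc r)) r<p))
  where
  r!≈0 : suc (suc r) ℕ.< p → + (suc r !) ≈ + 0 [ p ]
  r!≈0 r<p = ≈-trans (≈-reflexive (sym (Δ-x^n (suc r) 1)))
    (Δ-const r (λ y → (+ y) ^ suc r) 1 λ y 1≤y y≤ → h y 1≤y (ℕP.≤-<-trans y≤ r<p))

-- By Fermat, `M` may be replaced by its remainder modulo `p - 1`. A positive remainder is too small
-- by `x^r≈1⇒p≤1+r`, so no primitive root is required.
korselt : ∀ {p} → Prime p → ∀ M → (∀ a → a ^ suc M ≈ a [ p ]) → p ∸ 1 ℕD.∣ M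
korselt {zero}        pp M h = contradiction pp ¬prime[0]
korselt {suc zero}    pp M h = contradiction pp ¬prime[1]
korselt {suc (suc p)} pp M h = ℕD.m%n≡0⇒n∣m M (suc p) (r≡0 (M ℕ.% suc p) refl)
  where
  p∤ : ∀ {x} → 1 ℕ.≤ x → x ℕ.< suc (suc p) → ¬ (+ suc (suc p) ∣ + x)
  p∤ {suc x} _ x<p d = contradiction (ℕD.∣⇒≤ (∣⇒∣ᵤ d)) (ℕP.<⇒≱ x<p)

  q = M ℕ./ suc p

  split : ∀ x → (+ x) ^ M ≡ (+ x) ^ (M ℕ.% suc p) * (+ x) ^ (suc p ℕ.* q)
  split x = trans (cong ((+ x) ^_) (trans (ℕDM.m≡m%n+[m/n]*n M (suc p)) (cong (M ℕ.% suc p ℕ.+_) (ℕP.*-comm q (suc p)))))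
                  (^-distribˡ-+-* (+ x) (M ℕ.% suc p) (suc p ℕ.* q))

  power≈1 : ∀ x → 1 ℕ.≤ x → x ℕ.< suc (suc p) → (+ x) ^ (M ℕ.% suc p) ≈ + 1 [ suc (suc p) ]
  power≈1 x l u = ≈-trans (≈-sym x^M≈x^r)
    (*-cancelˡ-≈ pp (+ x) (p∤ l u) (≈-trans (h (+ x)) (≈-reflexive (sym (ℤP.*-identityʳ (+ x))))))
    where
    x^M≈x^r : (+ x) ^ M ≈ (+ x) ^ (M ℕ.% suc p) [ suc (suc p) ]
    x^M≈x^r = ≈-trans (≈-reflexive (split x))
      (≈-trans (*-cong-≈ (≈-refl {(+ x) ^ (M ℕ.% suc p)}) (≈1-^* {+ x} (suc p) q (fermat′ pp (+ x) (p∤ l u))))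
               (≈-reflexive (ℤP.*-identityʳ _)))

  r≡0 : ∀ r → M ℕ.% suc p ≡ r → M ℕ.% suc p ≡ 0
  r≡0 zero    eq = eq
  r≡0 (suc r) eq = contradiction
    (x^r≈1⇒p≤1+r pp r λ x l u → subst (λ t → (+ x) ^ t ≈ + 1 [ suc (suc p) ]) eq (power≈1 x l u))
    (ℕP.<⇒≱ (s≤s (subst (ℕ._< suc p) eq (ℕDM.m%n<n M (suc p)))))
-- Finiteness

≈-∣ : m ℕD.∣ n → a ≈ b [ n ] → a ≈ b [ m ]
≈-∣ m∣n (cong-mod d) = cong-mod (∣-trans (∣ᵤ⇒∣ m∣n) d)

-- As `n` exceeds `k`, the difference `n - k` is a successor. This removes the absolute value and
-- shows that the exponent is at least 2.
InC⇒≈ : ∀ {k n} → InC k n → ∃[ M ] (+ n ≡ k + + suc M × (∀ a → a ^ suc (suc M) ≈ a [ n ]))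
InC⇒≈ {k} {n} (k<n , _ , h) = go (+ n - k) refl
  where
  n≡ : ∀ {d} → + n - k ≡ d → + n ≡ k + d
  n≡ eq = trans (sym (lem (+ n) k)) (cong (λ d → k + d) eq)
    where
    lem : ∀ n k → k + (n - k) ≡ n
    lem = solve-∀

  go : ∀ d → + n - k ≡ d → ∃[ M ] (+ n ≡ k + + suc M × (∀ a → a ^ suc (suc M) ≈ a [ n ]))
  go (+ zero)  eq = contradiction (trans (n≡ eq) (ℤP.+-identityʳ k)) (ℤP.<⇒≢ k<n ∘ sym)
  go (+ suc M) eq = M , n≡ eq , λ a → cong-mod (∣ᵤ⇒∣ (subst (λ e → n ℕD.∣ ∣ a ^ e - a ∣) exponent (h a)))
    where
    exponent : ∣ + n - k + + 1 ∣ ≡ suc (suc M)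
    exponent = trans (cong (λ d → ∣ d + + 1 ∣) eq) (ℕP.+-comm (suc M) 1)
  go -[1+ M ]  eq = contradiction (subst (+ 0 ≤_) eq (ℤP.i≤j⇒0≤j-i (ℤP.<⇒≤ k<n))) λ ()

-- Taking `a = p`, the exponent is at least 2, so `p * p` divides the power and therefore `p`
-- itself.
InC⇒squarefree : ∀ {k p} → Prime p → ¬ InC k (p ℕ.* p)
InC⇒squarefree {k} {p} pp h = contradiction p*p≤p (ℕP.<⇒≱ p<p*p)
  where
  instance
    _ = prime⇒nonZero pp
    _ = prime⇒nonTrivial pp
  M = proj₁ (InC⇒≈ h)

  p*p∣p : + (p ℕ.* p) ∣ + p
  p*p∣p = ≈0⇒∣ (≈-trans (≈-sym (proj₂ (proj₂ (InC⇒≈ h)) (+ p)))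
    (∣⇒≈0 (divides ((+ p) ^ M) (trans (eq (+ p) ((+ p) ^ M)) (cong ((+ p) ^ M *_) (sym (pos-* p p)))))))
    where
    eq : ∀ x y → x * (x * y) ≡ y * (x * x)
    eq = solve-∀

  p*p≤p : p ℕ.* p ℕ.≤ p
  p*p≤p = ℕD.∣⇒≤ (∣⇒∣ᵤ p*p∣p)

  p<p*p : p ℕ.< p ℕ.* p
  p<p*p = ℕP.m<m*n p p (ℕ.nonTrivial⇒n>1 p)

-- Korselt's criterion gives `p - 1` dividing `p q - k`, which is `(p - 1) q + (q - k)`.
InC⇒p∸1∣q-k : ∀ {k p q} → Prime p → InC k (p ℕ.* q) → + (p ∸ 1) ∣ + q - k
InC⇒p∸1∣q-k {k} {zero}  {q} pp h = contradiction pp ¬prime[0]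
InC⇒p∸1∣q-k {k} {suc p} {q} pp h =
  subst (+ p ∣_) eq (∣m∣n⇒∣m-n {m = + suc M} {n = + p * + q}
    (∣ᵤ⇒∣ (korselt pp (suc M) λ a → ≈-∣ (ℕD.m∣m*n q) (proj₂ (proj₂ (InC⇒≈ h)) a)))
    (∣m⇒∣m*n (+ q) ∣-refl))
  where
  M = proj₁ (InC⇒≈ h)

  pq≡ : + suc p * + q ≡ k + + suc M
  pq≡ = trans (sym (pos-* (suc p) q)) (proj₁ (proj₂ (InC⇒≈ h)))

  eq₁ : ∀ k m p q → m - p * q ≡ k + m - (p * q + k)
  eq₁ = solve-∀
  eq₂ : ∀ k p q → (+ 1 + p) * q - (p * q + k) ≡ q - k
  eq₂ = solve-∀

  eq : + suc M - + p * + q ≡ + q - k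
  eq = trans (eq₁ k (+ suc M) (+ p) (+ q))
         (trans (cong (_- (+ p * + q + k)) (sym pq≡)) (eq₂ k (+ p) (+ q)))

-- Unless q is small compared with k, the quotient of p - k by q - 1 is 1 or - 1.  In the
-- first case p - 1 divides 2 (1 - k), in the second p + q = k + 1.
larger-bounded : ∀ {k p q} → p ℕ.< q → + suc p ≢ k →
  + p ∣ + suc q - k → + q ∣ + suc p - k → q ℕ.≤ 3 ℕ.* suc ∣ k ∣
larger-bounded {k} {p} {q} p<q p≢k p∣ (divides (+ 0) eq) = contradiction (ℤP.i-j≡0⇒i≡j (+ suc p) k eq) p≢k
larger-bounded {k} {p} {q} p<q p≢k p∣ (divides (+ 1) eq) =
  ℕP.≤-trans q≤ (ℕP.≤-trans (ℕP.+-monoˡ-≤ (suc ∣ k ∣) p≤) (ℕP.≤-reflexive (eq₃ ∣ k ∣)))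
  where
  q≡ : + q ≡ + suc p - k
  q≡ = trans (sym (ℤP.*-identityˡ (+ q))) (sym eq)

  q≤ : q ℕ.≤ p ℕ.+ suc ∣ k ∣
  q≤ = subst₂ ℕ._≤_ (cong ∣_∣ (sym q≡)) (sym (ℕP.+-suc p ∣ k ∣)) (ℤP.∣i-j∣≤∣i∣+∣j∣ (+ suc p) k)

  eq₁ : ∀ p k → + 1 + (+ 1 + p - k) - k - p ≡ + 2 * (+ 1 - k)
  eq₁ = solve-∀

  p∣2[1-k] : + p ∣ + 2 * (+ 1 - k)
  p∣2[1-k] = subst (+ p ∣_) (trans (cong (λ t → + 1 + t - k - + p) q≡) (eq₁ (+ p) k)) (∣m∣n⇒∣m-n p∣ ∣-refl)

  -- For `k = 1` the relation `q≡` would give `q = p`.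
  k≢1 : ∣ + 2 * (+ 1 - k) ∣ ≢ 0
  k≢1 h with ℤP.i*j≡0⇒i≡0∨j≡0 (+ 2) {+ 1 - k} (ℤP.∣i∣≡0⇒i≡0 h)
  ... | inj₂ h₁ with ℤP.i-j≡0⇒i≡j (+ 1) k h₁
  ...   | refl = ℕP.<⇒≢ p<q (sym (ℤP.+-injective q≡))

  p≤ : p ℕ.≤ 2 ℕ.* suc ∣ k ∣
  p≤ = ℕP.≤-trans (ℕD.∣⇒≤ {{ℕ.≢-nonZero k≢1}} (∣⇒∣ᵤ p∣2[1-k]))
         (subst (ℕ._≤ 2 ℕ.* suc ∣ k ∣) (sym (abs-* (+ 2) (+ 1 - k))) (ℕP.*-monoʳ-≤ 2 (ℤP.∣i-j∣≤∣i∣+∣j∣ (+ 1) k)))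

  eq₃ : ∀ k → 2 ℕ.* suc k ℕ.+ suc k ≡ 3 ℕ.* suc k
  eq₃ = ℕR.solve-∀
larger-bounded {k} {p} {q} p<q p≢k p∣ (divides (+ suc (suc t)) eq) =
  ℕP.≤-trans q≤∣k∣ (ℕP.≤-trans (ℕP.n≤1+n ∣ k ∣) (ℕP.m≤m+n (suc ∣ k ∣) (2 ℕ.* suc ∣ k ∣)))
  where
  open ℕP.≤-Reasoning

  -- A quotient of at least 2 gives `2 q ≤ (p + 1) + |k| ≤ q + |k|`.
  q≤∣k∣ : q ℕ.≤ ∣ k ∣
  q≤∣k∣ = ℕP.+-cancelˡ-≤ q q ∣ k ∣ (begin
    q ℕ.+ q                        ≤⟨ ℕP.+-monoʳ-≤ q (ℕP.m≤m+n q (t ℕ.* q)) ⟩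
    suc (suc t) ℕ.* q              ≡⟨ abs-* (+ suc (suc t)) (+ q) ⟨
    ∣ + suc (suc t) * + q ∣        ≡⟨ cong ∣_∣ eq ⟨
    ∣ + suc p - k ∣                ≤⟨ ℤP.∣i-j∣≤∣i∣+∣j∣ (+ suc p) k ⟩
    suc p ℕ.+ ∣ k ∣                ≤⟨ ℕP.+-monoˡ-≤ ∣ k ∣ p<q ⟩
    q ℕ.+ ∣ k ∣                    ∎)
larger-bounded {k} {p} {q} p<q p≢k p∣ (divides -[1+ t ] eq) =
  ℕP.≤-trans q≤∣k∣ (ℕP.≤-trans (ℕP.n≤1+n ∣ k ∣) (ℕP.m≤m+n (suc ∣ k ∣) (2 ℕ.* suc ∣ k ∣)))
  where
  eq₁ : ∀ p k q → k ≡ p + q - (p - k + q)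
  eq₁ = solve-∀
  eq₂ : ∀ t q → - t * q + t * q ≡ + 0
  eq₂ = solve-∀

  -- A negative quotient makes `k` positive and at least `q`.
  k≡ : k ≡ + (suc p ℕ.+ suc t ℕ.* q)
  k≡ = begin
    k
      ≡⟨ eq₁ (+ suc p) k (+ suc t * + q) ⟩
    + suc p + + suc t * + q - (+ suc p - k + + suc t * + q)
      ≡⟨ cong (λ d → + suc p + + suc t * + q - (d + + suc t * + q)) eq ⟩
    + suc p + + suc t * + q - (-[1+ t ] * + q + + suc t * + q)
      ≡⟨ cong (λ d → + suc p + + suc t * + q - d) (eq₂ (+ suc t) (+ q)) ⟩
    + suc p + + suc t * + q - + 0
      ≡⟨ ℤP.+-identityʳ _ ⟩
    + suc p + + suc t * + q
      ≡⟨ cong (λ d → + suc p + d) (pos-* (suc t) q) ⟨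
    + suc p + + (suc t ℕ.* q)
      ≡⟨ pos-+ (suc p) (suc t ℕ.* q) ⟨
    + (suc p ℕ.+ suc t ℕ.* q) ∎
    where open ≡-Reasoning

  q≤∣k∣ : q ℕ.≤ ∣ k ∣
  q≤∣k∣ = subst (q ℕ.≤_) (sym (cong ∣_∣ k≡))
    (ℕP.≤-trans (ℕP.m≤m+n q (t ℕ.* q)) (ℕP.m≤n+m (suc t ℕ.* q) (suc p)))

-- `larger-bounded` concerns the larger prime minus one, whence the outer `suc`; the smaller prime
-- obeys the same bound, whence the square.
bound : ℤ → ℕ
bound k = suc (3 ℕ.* suc ∣ k ∣) ℕ.* suc (3 ℕ.* suc ∣ k ∣)

pq≤bound : ∀ {k p q} → p ℕ.< q → + suc p ≢ k → + p ∣ + suc q - k → + q ∣ + suc p - k → suc p ℕ.* suc q ℕ.≤ bound k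
pq≤bound p<q p≢k p∣ q∣ = ℕP.*-mono-≤ (ℕP.≤-trans (s≤s (ℕP.<⇒≤ p<q)) (s≤s q≤)) (s≤s q≤)
  where q≤ = larger-bounded p<q p≢k p∣ q∣

InC-bounded : ∀ {k p q} → Prime p → Prime q → + p ≢ k → + q ≢ k → InC k (p ℕ.* q) → p ℕ.* q ℕ.≤ bound k
InC-bounded {p = zero}  pp pq p≢k q≢k h = contradiction pp ¬prime[0]
InC-bounded {p = suc p} {zero}  pp pq p≢k q≢k h = contradiction pq ¬prime[0]
InC-bounded {k} {suc p} {suc q} pp pq p≢k q≢k h with ℕP.<-cmp p q
... | tri< p<q _ _ = pq≤bound p<q p≢k (InC⇒p∸1∣q-k pp h) (InC⇒p∸1∣q-k pq h′)
  where h′ = subst (InC k) (ℕP.*-comm (suc p) (suc q)) h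
... | tri≈ _ refl _ = contradiction h (InC⇒squarefree pp)
... | tri> _ _ q<p = subst (ℕ._≤ bound k) (ℕP.*-comm (suc q) (suc p))
  (pq≤bound q<p q≢k (InC⇒p∸1∣q-k pq h′) (InC⇒p∸1∣q-k pp h))
  where h′ = subst (InC k) (ℕP.*-comm (suc p) (suc q)) h

finite-coprime : ∀ k → Finite (λ n → InC k n × DistinctPrimesCoprimeTo k n)
finite-coprime k = bound k , λ { _ (h , p , q , pp , pq , _ , refl , cp , cq) →
  InC-bounded pp pq (coprime⇒≢ pp cp) (coprime⇒≢ pq cq) h }
  where
  -- If `p` were `k`, it would be coprime to itself and hence 1.
  coprime⇒≢ : ∀ {p} → Prime p → Coprime p ∣ k ∣ → + p ≢ k
  coprime⇒≢ pp c refl with c (ℕD.∣-refl , ℕD.∣-refl)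
  ... | refl = ¬prime[1] pp

-- A prime factor equal to `k` would make `k` a positive prime, so `InC-bounded` applies. Both the
-- forward implication and claim (2) rest on this.
¬prime⇒bounded : ∀ {k} → ¬ IsPrimeℤ k → ∀ n → InC k n → TwoPrimeFactors n → n ℕ.≤ bound k
¬prime⇒bounded {k} ¬pk _ h (p , q , pp , pq , refl) = InC-bounded pp pq (prime⇒≢ pp) (prime⇒≢ pq) h
  where
  prime⇒≢ : ∀ {p} → Prime p → + p ≢ k
  prime⇒≢ pp refl = ¬pk (+<+ (ℕ.>-nonZero⁻¹ _ {{prime⇒nonZero pp}}) , pp)

isPrimeℤ? : ∀ k → Dec (IsPrimeℤ k)
isPrimeℤ? k = (+ 0 <? k) ×-dec prime? ∣ k ∣

infinite⇒prime : ∀ k → Infinite (λ n → InC k n × TwoPrimeFactors n) → IsPrimeℤ k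
infinite⇒prime k inf with isPrimeℤ? k
... | yes pk = pk
... | no ¬pk with inf (bound k)
...   | n , b<n , h , t = contradiction (¬prime⇒bounded ¬pk n h t) (ℕP.<⇒≱ b<n)

finite-dividing : ∀ k → (k < + 0 ⊎ ((+ 0 < k) × ¬ Prime ∣ k ∣)) → Finite (λ n → InC k n × TwoPrimesOneDividing k n)
finite-dividing k hk = bound k , λ { n (h , p , q , pp , pq , eq , _) → ¬prime⇒bounded (¬prime hk) n h (p , q , pp , pq , eq) }
  where
  ¬prime : (k < + 0 ⊎ ((+ 0 < k) × ¬ Prime ∣ k ∣)) → ¬ IsPrimeℤ k
  ¬prime (inj₁ k<0)       (0<k , _)  = ℤP.<-asym k<0 0<k
  ¬prime (inj₂ (_ , ¬pk)) (_   , pk) = ¬pk pk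
-- Primes congruent to 1 modulo m

prime-divisor : ∀ n → n ≢ 1 → ∃[ p ] (Prime p × p ℕD.∣ n)
-- Every prime divides 0; 2 is a default choice.
prime-divisor zero      n≢1 = 2 , prime[2] , 2 ℕD.∣0
prime-divisor n@(suc _) n≢1 with factorise n
... | record { factors = []     ; isFactorisation = eq }                        = contradiction eq n≢1
... | record { factors = p ∷ ps ; isFactorisation = eq ; factorsPrime = pp ∷ _ } =
  p , pp , subst (p ℕD.∣_) (sym eq) (ℕD.m∣m*n (product ps))

no-common-prime⇒coprime : (∀ {p} → Prime p → p ℕD.∣ m → p ℕD.∣ n → ⊥) → Coprime m n
no-common-prime⇒coprime h {d} (d∣m , d∣n) with d ℕ.≟ 1
... | yes d≡1 = d≡1
... | no d≢1 with prime-divisor d d≢1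
...   | p , pp , p∣d = ⊥-elim (h pp (ℕD.∣-trans p∣d d∣m) (ℕD.∣-trans p∣d d∣n))

coprime-∣ : ∀ i j k → Coprime ∣ i ∣ ∣ k ∣ → i ∣ j * k → i ∣ j
coprime-∣ i j k c h = ∣ᵤ⇒∣ (coprime-divisor c
  (subst (∣ i ∣ ℕD.∣_) (trans (abs-* j k) (ℕP.*-comm ∣ j ∣ ∣ k ∣)) (∣⇒∣ᵤ h)))

-- Bézout without subtraction: `Y ^ (g + v f)` is congruent to `Y ^ g` and is also a power of
-- `Y ^ e`, so `Y` need not be inverted.
≈1-^-comb : ∀ {Y} g u v e f → g ℕ.+ v ℕ.* f ≡ u ℕ.* e →
  Y ^ e ≈ + 1 [ n ] → Y ^ f ≈ + 1 [ n ] → Y ^ g ≈ + 1 [ n ]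
≈1-^-comb {n} {Y} g u v e f eq hₑ h = ≈-trans (≈-sym Y^[g+vf]≈Y^g) (subst (λ t → Y ^ t ≈ + 1 [ n ]) (sym eq) (multiple u e hₑ))
  where
  multiple : ∀ u e → Y ^ e ≈ + 1 [ n ] → Y ^ (u ℕ.* e) ≈ + 1 [ n ]
  multiple u e h = subst (λ t → Y ^ t ≈ + 1 [ n ]) (ℕP.*-comm e u) (≈1-^* {Y} e u h)

  Y^[g+vf]≈Y^g : Y ^ (g ℕ.+ v ℕ.* f) ≈ Y ^ g [ n ]
  Y^[g+vf]≈Y^g = ≈-trans (≈-reflexive (^-distribˡ-+-* Y g (v ℕ.* f)))
    (≈-trans (*-cong-≈ (≈-refl {Y ^ g}) (multiple v f h)) (≈-reflexive (ℤP.*-identityʳ (Y ^ g))))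

≈1-^-Bézout : ∀ {Y g e f} → Bézout.Identity g e f → Y ^ e ≈ + 1 [ n ] → Y ^ f ≈ + 1 [ n ] → Y ^ g ≈ + 1 [ n ]
≈1-^-Bézout {g = g} {e} {f} (Bézout.+- u v eq) hₑ h = ≈1-^-comb g u v e f eq hₑ h
≈1-^-Bézout {g = g} {e} {f} (Bézout.-+ u v eq) hₑ h = ≈1-^-comb g v u f e eq h hₑ

-- Geometric sums and powers

geometric : ℤ → ℕ → ℤ
geometric y zero    = + 0
geometric y (suc r) = + 1 + y * geometric y r

[y-1]*geometric : ∀ y r → (y - + 1) * geometric y r ≡ y ^ r - + 1
[y-1]*geometric y zero    = ℤP.*-zeroʳ (y - + 1)
[y-1]*geometric y (suc r) = begin
  (y - + 1) * (+ 1 + y * geometric y r)       ≡⟨ eq₁ y (geometric y r) ⟩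
  y - + 1 + y * ((y - + 1) * geometric y r)   ≡⟨ cong (λ t → y - + 1 + y * t) ([y-1]*geometric y r) ⟩
  y - + 1 + y * (y ^ r - + 1)                 ≡⟨ eq₂ y (y ^ r) ⟩
  y * y ^ r - + 1                             ∎
  where
  open ≡-Reasoning
  eq₁ : ∀ y s → (y - + 1) * (+ 1 + y * s) ≡ y - + 1 + y * ((y - + 1) * s)
  eq₁ = solve-∀
  eq₂ : ∀ y z → y - + 1 + y * (z - + 1) ≡ y * z - + 1
  eq₂ = solve-∀

-- All `r` summands become 1; hence a common prime divisor of `y - 1` and the sum divides `r`.
geometric≈ : ∀ {y} → y ≈ + 1 [ n ] → ∀ r → geometric y r ≈ + r [ n ]
geometric≈ y≈1 zero    = ≈-refl
geometric≈ y≈1 (suc r) = ≈-trans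
  (+-cong-≈ (≈-refl {+ 1}) (*-cong-≈ y≈1 (geometric≈ y≈1 r)))
  (≈-reflexive (cong (λ t → + 1 + t) (ℤP.*-identityˡ (+ r))))

∣-^ : ∀ X e → X ∣ X ^ suc e
∣-^ X e = ∣m⇒∣m*n (X ^ e) ∣-refl

^-∣-^ : ∀ X {e f} → e ℕ.≤ f → X ^ e ∣ X ^ f
^-∣-^ X {e} {f} e≤f = subst (X ^ e ∣_)
  (trans (sym (^-distribˡ-+-* X e (f ∸ e))) (cong (X ^_) (ℕP.m+[n∸m]≡n e≤f))) (∣m⇒∣m*n (X ^ (f ∸ e)) ∣-refl)

prime∣⇒^≉1 : ∀ {q X} → Prime q → + q ∣ X → ∀ e .{{_ : NonZero e}} → ¬ X ^ e ≈ + 1 [ q ]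
prime∣⇒^≉1 {X = X} pq q∣X (suc e) h = prime∤1 pq (≈0⇒∣ (≈-trans (≈-sym h) (∣⇒≈0 (∣-trans q∣X (∣-^ X e)))))

∣-square-cancel : ∀ {y} a b → y ∣ (a * b) * (a * b) - + 1 → y ∣ b * b - + 1 → y ∣ a * a - + 1
∣-square-cancel {y} a b h₁ h₂ = subst (y ∣_) (eq a b) (∣m∣n⇒∣m-n h₁ (∣n⇒∣m*n (a * a) h₂))
  where
  eq : ∀ a b → (a * b) * (a * b) - + 1 - a * a * (b * b - + 1) ≡ a * a - + 1
  eq = solve-∀

-- Half of an order condition: no prime below `b` can be removed from the exponent `m`. Once `b`
-- exceeds all prime factors of `m`, this and `X ^ m ≈ 1` say that `X` has order `m` modulo `q`.
Good : ℕ → ℤ → ℕ → ℕ → Set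
Good q X m b = ∀ r e → Prime r → r ℕ.< b → r ℕ.* e ≡ m → ¬ X ^ e ≈ + 1 [ q ]

-- When b exceeds all prime factors of m, Φ plays the part of the m-th cyclotomic polynomial at X:
-- the primes dividing it are those modulo which X has order m.  The last two fields serve to show
-- Φ ≠ ± 1; unlike a congruence for Φ, they pass to quotients without a case distinction on signs.
record Cyclotomic (X : ℤ) (d b m : ℕ) : Set where
  field
    Φ Ψ      : ℤ
    Φ*Ψ      : Φ * Ψ ≡ X ^ m - + 1
    Φ⇒good   : ∀ {q} → Prime q → + q ∣ Φ → Good q X m b
    Ψ⇒¬good  : ∀ {q} → Prime q → + q ∣ Ψ → ¬ Good q X m b
    Φ²≡1     : X ^ d ∣ Φ * Φ - + 1
    Φ²≢1     : ¬ X ^ suc d ∣ Φ * Φ - + 1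

  Φ⇒≈1 : ∀ {q} → + q ∣ Φ → X ^ m ≈ + 1 [ q ]
  Φ⇒≈1 q∣Φ = cong-mod (subst (_ ∣_) Φ*Ψ (∣m⇒∣m*n Ψ q∣Φ))

-- With no primes treated yet, `Φ` is `y - 1` for `y = X ^ suc d`, and `Φ * Φ - 1 = y (y - 2)`. One
-- more factor `X` would have to divide 2, which `3 ≤ x` excludes.
cyclotomic-base : ∀ {x} d → 3 ℕ.≤ x → Cyclotomic (+ x) (suc d) 0 (suc d)
cyclotomic-base {x} d 3≤x = record
  { Φ       = X ^ suc d - + 1
  ; Ψ       = + 1
  ; Φ*Ψ     = ℤP.*-identityʳ _
  ; Φ⇒good  = λ _ _ _ _ _ ()
  ; Ψ⇒¬good = λ pq q∣1 _ → prime∤1 pq q∣1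
  ; Φ²≡1    = divides (X ^ suc d - + 2) (trans (eq (X ^ suc d)) (ℤP.*-comm (X ^ suc d) (X ^ suc d - + 2)))
  ; Φ²≢1    = λ h → contradiction
                (ℕD.∣⇒≤ (∣⇒∣ᵤ (X∣2 (*-cancelʳ-∣ (X ^ suc d) {{nonZero}}
                  (subst (X * X ^ suc d ∣_) (trans (eq (X ^ suc d)) (ℤP.*-comm (X ^ suc d) (X ^ suc d - + 2))) h)))))
                (ℕP.<⇒≱ 3≤x)
  }
  where
  X = + x

  eq : ∀ y → (y - + 1) * (y - + 1) - + 1 ≡ y * (y - + 2)
  eq = solve-∀

  nonZero : ℤ.NonZero (X ^ suc d)
  nonZero = ℤ.≢-nonZero λ X^d≡0 → contradiction (ℤP.+-injective (ℤP.i^n≡0⇒i≡0 X (suc d) X^d≡0))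
    λ { refl → contradiction 3≤x λ () }

  X∣2 : X ∣ X ^ suc d - + 2 → X ∣ + 2
  X∣2 h = subst (X ∣_) (eq₂ (X ^ suc d)) (∣m∣n⇒∣m-n (∣-^ X d) h)
    where
    eq₂ : ∀ y → y - (y - + 2) ≡ + 2
    eq₂ = solve-∀

cyclotomic-skip : ∀ {X d b m} → ¬ Prime b → Cyclotomic X d b m → Cyclotomic X d (suc b) m
cyclotomic-skip {X} {d} {b} {m} ¬pb A = record
  { Φ       = Φ
  ; Ψ       = Ψ
  ; Φ*Ψ     = Φ*Ψ
  ; Φ⇒good  = λ pq q∣Φ r e pr r<1+b → Φ⇒good pq q∣Φ r e pr (below pr r<1+b)
  ; Ψ⇒¬good = λ pq q∣Ψ g → Ψ⇒¬good pq q∣Ψ λ r e pr r<b → g r e pr (ℕP.m<n⇒m<1+n r<b)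
  ; Φ²≡1    = Φ²≡1
  ; Φ²≢1    = Φ²≢1
  }
  where
  open Cyclotomic A
  below : ∀ {r} → Prime r → r ℕ.< suc b → r ℕ.< b
  below pr r<1+b = ℕP.≤∧≢⇒< (ℕP.≤-pred r<1+b) λ { refl → ¬pb pr }

module _ {X d r F} .{{_ : NonZero d}} .{{_ : NonZero F}} (pr : Prime r) (r∣X : + r ∣ X)
  (A : Cyclotomic X (d ℕ.* r) r (r ℕ.* F)) (B : Cyclotomic X d r F) where

  private
    module A = Cyclotomic A
    module B = Cyclotomic B

    X^rF : X ^ (r ℕ.* F) - + 1 ≡ (X ^ F - + 1) * geometric (X ^ F) r
    X^rF = sym (trans ([y-1]*geometric (X ^ F) r)
      (cong (_- + 1) (trans (^-*-assoc X F r) (cong (X ^_) (ℕP.*-comm F r)))))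

    -- A prime `s < r` dividing `r F` divides `F`, say `F = g s`. If it could be removed from `r F`,
    -- then `X ^ (g r)` and `X ^ (g s)` would both be 1 modulo `q`, so `X ^ g` would be 1 by
    -- coprimality of `r` and `s`, against `B`.
    disjoint : ∀ {q} → Prime q → q ℕD.∣ ∣ B.Φ ∣ → q ℕD.∣ ∣ A.Ψ ∣ → ⊥
    disjoint {q} pq q∣ΦB q∣ΨA = A.Ψ⇒¬good pq (∣ᵤ⇒∣ q∣ΨA) good
      where
      good : Good q X (r ℕ.* F) r
      good s e ps s<r se≡rF X^e≈1 with euclidsLemma r F ps (ℕD.divides e (trans (sym se≡rF) (ℕP.*-comm s e)))
      ... | inj₁ s∣r = [ (λ { refl → ¬prime[1] ps }) , (λ { refl → ℕP.<-irrefl refl s<r }) ]′ (prime⇒irreducible pr s∣r)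
      ... | inj₂ (ℕD.divides g F≡gs) = B.Φ⇒good pq (∣ᵤ⇒∣ q∣ΦB) s g ps s<r (trans (ℕP.*-comm s g) (sym F≡gs)) X^g≈1
        where
        instance _ = prime⇒nonZero ps

        e≡gr : e ≡ g ℕ.* r
        e≡gr = ℕP.*-cancelˡ-≡ e (g ℕ.* r) s (trans se≡rF (trans (cong (r ℕ.*_) F≡gs) (eq r g s)))
          where
          eq : ∀ r g s → r ℕ.* (g ℕ.* s) ≡ s ℕ.* (g ℕ.* r)
          eq = ℕR.solve-∀

        X^g≈1 : X ^ g ≈ + 1 [ q ]
        X^g≈1 = ≈-trans (≈-reflexive (sym (ℤP.^-identityʳ (X ^ g))))
          (≈1-^-Bézout {Y = X ^ g} (coprime-Bézout (prime⇒coprime pr s<r))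
            (≈-trans (≈-reflexive (trans (^-*-assoc X g r) (cong (X ^_) (sym e≡gr)))) X^e≈1)
            (≈-trans (≈-reflexive (trans (^-*-assoc X g s) (cong (X ^_) (sym F≡gs)))) (B.Φ⇒≈1 (∣ᵤ⇒∣ q∣ΦB))))

    ΦB∣X^rF-1 : B.Φ ∣ A.Φ * A.Ψ
    ΦB∣X^rF-1 = divides (B.Ψ * geometric (X ^ F) r) (begin
      A.Φ * A.Ψ                            ≡⟨ A.Φ*Ψ ⟩
      X ^ (r ℕ.* F) - + 1                  ≡⟨ X^rF ⟩
      (X ^ F - + 1) * geometric (X ^ F) r  ≡⟨ cong (_* geometric (X ^ F) r) B.Φ*Ψ ⟨
      B.Φ * B.Ψ * geometric (X ^ F) r      ≡⟨ eq B.Φ B.Ψ (geometric (X ^ F) r) ⟩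
      B.Ψ * geometric (X ^ F) r * B.Φ      ∎)
      where
      open ≡-Reasoning
      eq : ∀ u v w → u * v * w ≡ v * w * u
      eq = solve-∀

    ΦB∣ΦA : B.Φ ∣ A.Φ
    ΦB∣ΦA = coprime-∣ B.Φ A.Φ A.Ψ (no-common-prime⇒coprime disjoint) ΦB∣X^rF-1

  -- For r prime, the value at X of the polynomial for r f is that for f at X ^ r divided by that
  -- at X, as for cyclotomic polynomials.
  cyclotomic-prime : Cyclotomic X d (suc r) (r ℕ.* F)
  cyclotomic-prime = quotient ΦB∣ΦA
    where
    quotient : B.Φ ∣ A.Φ → Cyclotomic X d (suc r) (r ℕ.* F)
    quotient (divides Φ ΦA≡) = record
      { Φ       = Φ
      ; Ψ       = A.Ψ * B.Φ
      ; Φ*Ψ     = trans (eq₁ Φ A.Ψ B.Φ) (trans (cong (_* A.Ψ) (sym ΦA≡)) A.Φ*Ψ)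
      ; Φ⇒good  = Φ⇒good
      ; Ψ⇒¬good = Ψ⇒¬good
      -- Since `d r > d`, the square of `A.Φ = Φ * B.Φ` is 1 modulo `X ^ suc d`, so the squares of
      -- `Φ` and `B.Φ` are 1 modulo the same powers of `X` up to that one.
      ; Φ²≡1    = ∣-square-cancel Φ B.Φ (ΦA²≡1 (^-∣-^ X (ℕP.<⇒≤ d<dr))) B.Φ²≡1
      ; Φ²≢1    = λ h → B.Φ²≢1 (∣-square-cancel B.Φ Φ
                    (subst (λ t → X ^ suc d ∣ t * t - + 1) (ℤP.*-comm Φ B.Φ) (ΦA²≡1 (^-∣-^ X d<dr))) h)
      }
      where
      eq₁ : ∀ u v w → u * (v * w) ≡ u * w * v
      eq₁ = solve-∀

      d<dr : d ℕ.< d ℕ.* r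
      d<dr = ℕP.m<m*n d r (ℕ.nonTrivial⇒n>1 r {{prime⇒nonTrivial pr}})

      ≈1-^r* : ∀ {q} e → X ^ e ≈ + 1 [ q ] → X ^ (r ℕ.* e) ≈ + 1 [ q ]
      ≈1-^r* {q} e h = subst (λ t → X ^ t ≈ + 1 [ q ]) (ℕP.*-comm e r) (≈1-^* {X} e r h)

      ΦA²≡1 : ∀ {y} → y ∣ X ^ (d ℕ.* r) → y ∣ (Φ * B.Φ) * (Φ * B.Φ) - + 1
      ΦA²≡1 h = ∣-trans h (subst (λ t → X ^ (d ℕ.* r) ∣ t * t - + 1) ΦA≡ A.Φ²≡1)

      ΦB≢0 : B.Φ ≢ + 0
      ΦB≢0 ΦB≡0 = prime∣⇒^≉1 pr r∣X F
        (≈-reflexive (ℤP.i-j≡0⇒i≡j (X ^ F) (+ 1) (trans (sym B.Φ*Ψ) (cong (_* B.Ψ) ΦB≡0))))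

      ΦΨA≡ : Φ * A.Ψ ≡ B.Ψ * geometric (X ^ F) r
      ΦΨA≡ = ℤP.*-cancelʳ-≡ (Φ * A.Ψ) (B.Ψ * geometric (X ^ F) r) B.Φ {{ℤ.≢-nonZero ΦB≢0}} (begin
        Φ * A.Ψ * B.Φ                    ≡⟨ eq Φ A.Ψ B.Φ ⟩
        Φ * B.Φ * A.Ψ                    ≡⟨ cong (_* A.Ψ) ΦA≡ ⟨
        A.Φ * A.Ψ                        ≡⟨ _∣_.equality ΦB∣X^rF-1 ⟩
        B.Ψ * geometric (X ^ F) r * B.Φ  ∎)
        where
        open ≡-Reasoning
        eq : ∀ u v w → u * v * w ≡ u * w * v
        eq = solve-∀

      -- The condition for the new prime `r`. By `ΦΨA≡`, `q` divides `B.Ψ`, where goodness for `r F`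
      -- passes down to `F`, or the geometric sum. In the latter case `q` divides `r` and so `X`,
      -- whose powers are then 0.
      X^F≉1 : ∀ {q} → Prime q → + q ∣ Φ → ¬ X ^ F ≈ + 1 [ q ]
      X^F≉1 {q} pq q∣Φ X^F≈1 =
        [ q∤ΨB , q∤S ]′ (euclid pq B.Ψ (geometric (X ^ F) r) (subst (+ q ∣_) ΦΨA≡ (∣m⇒∣m*n {m = Φ} A.Ψ q∣Φ)))
        where
        eq : ∀ s r e → s ℕ.* (r ℕ.* e) ≡ r ℕ.* (s ℕ.* e)
        eq = ℕR.solve-∀

        q∤ΨB : ¬ + q ∣ B.Ψ
        q∤ΨB q∣ΨB = B.Ψ⇒¬good pq q∣ΨB λ s e ps s<r se≡F X^e≈1 →
          A.Φ⇒good pq (subst (+ q ∣_) (sym ΦA≡) (∣m⇒∣m*n {m = Φ} B.Φ q∣Φ)) s (r ℕ.* e) ps s<r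
            (trans (eq s r e) (cong (r ℕ.*_) se≡F)) (≈1-^r* e X^e≈1)

        q∤S : ¬ + q ∣ geometric (X ^ F) r
        q∤S q∣S =
          prime∣⇒^≉1 pq (∣-trans (≈0⇒∣ (≈-trans (≈-sym (geometric≈ X^F≈1 r)) (∣⇒≈0 q∣S))) r∣X) F X^F≈1

      Φ⇒good : ∀ {q} → Prime q → + q ∣ Φ → Good q X (r ℕ.* F) (suc r)
      Φ⇒good {q} pq q∣Φ s e ps s<1+r se≡rF with ℕP.m≤n⇒m<n∨m≡n (ℕP.≤-pred s<1+r)
      ... | inj₁ s<r  = A.Φ⇒good pq (subst (+ q ∣_) (sym ΦA≡) (∣m⇒∣m*n {m = Φ} B.Φ q∣Φ)) s e ps s<r se≡rF
      ... | inj₂ refl = subst (λ t → ¬ X ^ t ≈ + 1 [ q ])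
                          (sym (ℕP.*-cancelˡ-≡ e F r {{prime⇒nonZero pr}} se≡rF)) (X^F≉1 pq q∣Φ)

      Ψ⇒¬good : ∀ {q} → Prime q → + q ∣ A.Ψ * B.Φ → ¬ Good q X (r ℕ.* F) (suc r)
      Ψ⇒¬good pq h good with euclid pq A.Ψ B.Φ h
      ... | inj₁ q∣ΨA = A.Ψ⇒¬good pq q∣ΨA λ s e ps s<r → good s e ps (ℕP.m<n⇒m<1+n s<r)
      ... | inj₂ q∣ΦB = good r F pr (ℕP.n<1+n r) refl (B.Φ⇒≈1 q∣ΦB)

-- Cyclotomic values along primorials

data Primorial : ℕ → ℕ → Set where
  base  : Primorial 0 1
  prime : ∀ {b P} → Prime b → Primorial b P → Primorial (suc b) (b ℕ.* P)
  skip  : ∀ {b P} → ¬ Prime b → Primorial b P → Primorial (suc b) P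

primorial : ∀ b → ∃[ P ] Primorial b P
primorial zero    = 1 , base
primorial (suc b) with prime? b | primorial b
... | yes pb | P , h = b ℕ.* P , prime pb h
... | no ¬pb | P , h = P , skip ¬pb h

primorial≢0 : ∀ {b P} → Primorial b P → NonZero P
primorial≢0 base = _
primorial≢0 (prime {b} {P′} pb h) = ℕP.m*n≢0 b P′ {{prime⇒nonZero pb}} {{primorial≢0 h}}
primorial≢0 (skip _ h) = primorial≢0 h

prime∣primorial⇒< : ∀ {b P r} → Primorial b P → Prime r → r ℕD.∣ P → r ℕ.< b
prime∣primorial⇒< base pr r∣1 with ℕD.∣1⇒≡1 r∣1
... | refl = contradiction pr ¬prime[1]
prime∣primorial⇒< (prime {b} {P} pb h) pr r∣bP with euclidsLemma b P pr r∣bP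
... | inj₁ r∣b = s≤s (ℕD.∣⇒≤ {{prime⇒nonZero pb}} r∣b)
... | inj₂ r∣P = ℕP.m<n⇒m<1+n (prime∣primorial⇒< h pr r∣P)
prime∣primorial⇒< (skip _ h) pr r∣P = ℕP.m<n⇒m<1+n (prime∣primorial⇒< h pr r∣P)

-- Adjoining the prime `b` divides the value for `suc d * b` by that for `suc d`, both over the
-- smaller primorial; the induction therefore varies `d`.
cyclotomic : ∀ {b P x} → Primorial b P → 3 ℕ.≤ x → P ℕD.∣ x →
  ∀ d m → suc m ≡ suc d ℕ.* P → Cyclotomic (+ x) (suc d) b (suc m)
cyclotomic base 3≤x _ d m eq with trans eq (ℕP.*-identityʳ (suc d))
... | refl = cyclotomic-base d 3≤x
cyclotomic (skip ¬pb h) 3≤x P∣x d m eq = cyclotomic-skip ¬pb (cyclotomic h 3≤x P∣x d m eq)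
cyclotomic (prime {zero} pb h) 3≤x bP∣x d m eq = contradiction pb ¬prime[0]
cyclotomic (prime {suc b′} {zero} pb h) 3≤x bP∣x d m eq = contradiction (primorial≢0 h) λ ()
cyclotomic {x = x} (prime {b@(suc b′)} {P@(suc P′)} pb h) 3≤x bP∣x d m eq =
  subst (Cyclotomic (+ x) (suc d) (suc b)) (sym m≡)
    (cyclotomic-prime pb (∣ᵤ⇒∣ (ℕD.m*n∣⇒m∣ b P bP∣x))
      (subst (Cyclotomic (+ x) (suc d ℕ.* b) b) m≡
        -- `b′ + d * b` is the predecessor of `suc d * b`; likewise `P′ + d * P` below for
        -- `suc d * P`.
        (cyclotomic h 3≤x P∣x (b′ ℕ.+ d ℕ.* b) m (trans eq (sym (ℕP.*-assoc (suc d) b P)))))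
      (cyclotomic h 3≤x P∣x d (P′ ℕ.+ d ℕ.* P) refl))
  where
  P∣x = ℕD.m*n∣⇒n∣ b P bP∣x

  m≡ : suc m ≡ b ℕ.* (suc d ℕ.* P)
  m≡ = trans eq (lem (suc d) b P)
    where
    lem : ∀ d b P → d ℕ.* (b ℕ.* P) ≡ b ℕ.* (d ℕ.* P)
    lem = ℕR.solve-∀

-- Fermat and Bézout give `X ^ g ≈ 1` for `g = gcd m (q - 1)`. If `g` were a proper divisor of `m`,
-- some prime could be removed from `m` leaving a multiple of `g`.
order≡m⇒∣ : ∀ {q X b m} .{{_ : NonZero m}} → Prime q → Good q X m b → (∀ {r} → Prime r → r ℕD.∣ m → r ℕ.< b) →
  X ^ m ≈ + 1 [ q ] → m ℕD.∣ q ∸ 1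
order≡m⇒∣ {q} {X} {b} {m} pq good small X^m≈1 with gcd[m,n]∣m m (q ∸ 1)
... | ℕD.divides h m≡h*g with h ℕ.≟ 1
...   | yes refl = subst (ℕD._∣ q ∸ 1) (sym (trans m≡h*g (ℕP.*-identityˡ _))) (gcd[m,n]∣n m (q ∸ 1))
...   | no h≢1 with prime-divisor h h≢1
...     | r , pr , ℕD.divides t h≡t*r =
  contradiction (≈1-^* {X} g t X^g≈1)
    (good r (g ℕ.* t) pr (small pr (ℕD.divides (g ℕ.* t) m≡)) (trans (ℕP.*-comm r (g ℕ.* t)) (sym m≡)))
  where
  g = gcd m (q ∸ 1)

  m≡ : m ≡ g ℕ.* t ℕ.* r
  m≡ = trans m≡h*g (trans (cong (ℕ._* g) h≡t*r) (eq t r g))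
    where
    eq : ∀ t r g → t ℕ.* r ℕ.* g ≡ g ℕ.* t ℕ.* r
    eq = ℕR.solve-∀

  X^g≈1 : X ^ g ≈ + 1 [ q ]
  X^g≈1 = ≈1-^-Bézout (Bézout.identity (gcd-GCD m (q ∸ 1))) X^m≈1
    (fermat′ pq X λ q∣X → prime∣⇒^≉1 pq q∣X m X^m≈1)

∣i∣≡1⇒i*i≡1 : ∀ i → ∣ i ∣ ≡ 1 → i * i ≡ + 1
∣i∣≡1⇒i*i≡1 (+ 1)    refl = refl
∣i∣≡1⇒i*i≡1 -[1+ 0 ] refl = refl

prime≡1 : ∀ m → ∃[ q ] (Prime q × suc m ℕD.∣ q ∸ 1)
prime≡1 m with primorial (suc (suc m))
... | zero        , h = contradiction (primorial≢0 h) λ ()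
... | P@(suc P′)  , h = q , pq , ℕD.∣-trans (ℕD.m∣m*n P) (order≡m⇒∣ {X = X} pq (Φ⇒good pq q∣Φ) small (Φ⇒≈1 q∣Φ))
  where
  -- The factor 3 ensures `3 ≤ x`. The exponent `suc m * P` has only prime factors below
  -- `suc (suc m)`, all of them treated.
  X = + (3 ℕ.* P)

  open Cyclotomic (cyclotomic {x = 3 ℕ.* P} h (ℕP.m≤m*n 3 P) (ℕD.n∣m*n 3) m (P′ ℕ.+ m ℕ.* P) refl)

  ∣Φ∣≢1 : ∣ Φ ∣ ≢ 1
  -- For `Φ` a unit, `Φ * Φ - 1` is 0, which every power of `X` divides.
  ∣Φ∣≢1 ∣Φ∣≡1 = Φ²≢1 (divides (+ 0) (cong (_- + 1) (∣i∣≡1⇒i*i≡1 Φ ∣Φ∣≡1)))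

  divisor = prime-divisor ∣ Φ ∣ ∣Φ∣≢1
  q  = proj₁ divisor
  pq = proj₁ (proj₂ divisor)

  q∣Φ : + q ∣ Φ
  q∣Φ = ∣ᵤ⇒∣ (proj₂ (proj₂ divisor))

  small : ∀ {r} → Prime r → r ℕD.∣ suc m ℕ.* P → r ℕ.< suc (suc m)
  small pr r∣ with euclidsLemma (suc m) P pr r∣
  ... | inj₁ r∣m = s≤s (ℕD.∣⇒≤ r∣m)
  ... | inj₂ r∣P = prime∣primorial⇒< h pr r∣P

-- The products k q with k prime and q ≡ 1 modulo k - 1

p-1∣M⇒a^[1+M]≈a : ∀ {p M} → Prime p → p ∸ 1 ℕD.∣ M → ∀ a → a ^ suc M ≈ a [ p ]
p-1∣M⇒a^[1+M]≈a {p} pp (ℕD.divides t refl) a with + p ∣? a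
... | yes p∣a = ≈-trans (∣⇒≈0 (∣m⇒∣m*n (a ^ (t ℕ.* (p ∸ 1))) p∣a)) (≈-sym (∣⇒≈0 p∣a))
... | no  p∤a = ≈-trans (*-cong-≈ (≈-refl {a}) a^M≈1) (≈-reflexive (ℤP.*-identityʳ a))
  where
  a^M≈1 : a ^ (t ℕ.* (p ∸ 1)) ≈ + 1 [ p ]
  a^M≈1 = subst (λ e → a ^ e ≈ + 1 [ p ]) (ℕP.*-comm (p ∸ 1) t) (≈1-^* {a} (p ∸ 1) t (fermat′ pp a p∤a))

coprime-*-∣ : ∀ {j} → Coprime m n → m ℕD.∣ j → n ℕD.∣ j → m ℕ.* n ℕD.∣ j
coprime-*-∣ {m} {n} c (ℕD.divides t refl) n∣j =
  subst (m ℕ.* n ℕD.∣_) (ℕP.*-comm m t)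
    (ℕD.*-monoʳ-∣ m (coprime-divisor (ℕC.sym c) (subst (n ℕD.∣_) (ℕP.*-comm t m) n∣j)))

-- Here `n - k = k (q - 1)` is a multiple of both `k - 1` and `q - 1`, so the congruence holds
-- modulo each of the two coprime factors.
InC-kq : ∀ {k q} → Prime k → Prime q → k ℕ.< q → k ∸ 1 ℕD.∣ q ∸ 1 → InC (+ k) (k ℕ.* q)
InC-kq {q = zero} _ pq _ _ = contradiction pq ¬prime[0]
InC-kq {k} {suc q} pk pq k<q k-1∣q-1 =
  +<+ (ℕP.m<m*n k (suc q) (ℕ.nonTrivial⇒n>1 (suc q))) , ℕ.>-nonZero⁻¹ (k ℕ.* suc q) {{ℕP.m*n≢0 k (suc q)}} , λ a →
  subst (λ e → k ℕ.* suc q ℕD.∣ ∣ a ^ e - a ∣) (sym exponent)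
    (coprime-*-∣ (ℕC.sym (prime⇒coprime pq k<q))
      (∣⇒∣ᵤ (difference (p-1∣M⇒a^[1+M]≈a pk (ℕD.∣-trans k-1∣q-1 (ℕD.n∣m*n k)) a)))
      (∣⇒∣ᵤ (difference (p-1∣M⇒a^[1+M]≈a pq (ℕD.n∣m*n k) a))))
  where
  instance
    _ = prime⇒nonZero pk
    _ = prime⇒nonTrivial pq

  exponent : ∣ + (k ℕ.* suc q) - + k + + 1 ∣ ≡ suc (k ℕ.* q)
  exponent = trans (cong (λ t → ∣ t + + 1 ∣) kq-k≡) (ℕP.+-comm (k ℕ.* q) 1)
    where
    eq : ∀ k q → k * (+ 1 + q) - k ≡ k * q
    eq = solve-∀
    kq-k≡ : + (k ℕ.* suc q) - + k ≡ + (k ℕ.* q)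
    kq-k≡ = trans (cong (_- + k) (pos-* k (suc q))) (trans (eq (+ k) (+ q)) (sym (pos-* k q)))

prime⇒infinite : ∀ k → IsPrimeℤ k → Infinite (λ n → InC k n × TwoPrimeFactors n)
prime⇒infinite (+ zero)        (_ , pk) N = contradiction pk ¬prime[0]
prime⇒infinite (+ suc zero)    (_ , pk) N = contradiction pk ¬prime[1]
prime⇒infinite -[1+ _ ]        (() , _) N
-- The modulus is `(N + k + 1) (k - 1)`: a multiple of `k - 1`, and large enough to force
-- `q > N + k`.
prime⇒infinite (+ k@(suc (suc k′))) (_ , pk) N with prime≡1 (k′ ℕ.+ (N ℕ.+ k) ℕ.* suc k′)
... | q , pq , m∣q-1 = k ℕ.* q , ℕP.<-≤-trans (ℕP.≤-<-trans (ℕP.m≤m+n N k) N+k<q) (ℕP.m≤n*m q k)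
                     , InC-kq pk pq (ℕP.≤-<-trans (ℕP.m≤n+m k N) N+k<q) (ℕD.∣-trans (ℕD.n∣m*n (suc (N ℕ.+ k))) m∣q-1)
                     , k , q , pk , pq , refl
  where
  instance _ = ℕ.>-nonZero (ℕP.m<n⇒0<n∸m (ℕ.nonTrivial⇒n>1 q {{prime⇒nonTrivial pq}}))

  N+k<q : N ℕ.+ k ℕ.< q
  N+k<q = ℕP.≤-trans (ℕP.m≤m*n (suc (N ℕ.+ k)) (suc k′)) (ℕP.≤-trans (ℕD.∣⇒≤ m∣q-1) (ℕP.m∸n≤m q 1))

theorem5p1 : (k : ℤ) →
    (Infinite (λ n → InC k n × TwoPrimeFactors n) ⇔ IsPrimeℤ k)
    × Finite (λ n → InC k n × DistinctPrimesCoprimeTo k n)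
    × ((k < + 0 ⊎ ((+ 0 < k) × ¬ Prime ∣ k ∣)) →
    Finite (λ n → InC k n × TwoPrimesOneDividing k n))
theorem5p1 k = mk⇔ (infinite⇒prime k) (prime⇒infinite k) , finite-coprime k , finite-dividing k
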